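{- Let $\mathcal{C}$ be a set, used as the interpretation of the base type $o$. Let $\Gamma\vdash M:A$ be a simply-typed $\lambda$-term (over the single base type $o$). Then the interpretation of $M$ in the linear Scott model is the down-closure of its interpretation in the relational model: $$[\![M]\!]_{\mathrm{ScottL}_!}\;=\;\big[\,[\![M]\!]_{\mathrm{Rel}_!}\,\big]\,,$$ where for a subset $X\subseteq \mathcal{M}_f([\![\Gamma]\!])\times[\![A]\!]$, the set $[X]$ consists of all $(\mu,a)$ such that there is $(\mu',a')\in X$ with $\mu'\leq_{![\![\Gamma]\!]}\mu$ and $a\leq_{[\![A]\!]}a'$.
   Context: Simple types are generated by $o$ and $A\to B$; terms are variables, abstractions $\lambda x^A.M$ and applications $M\,N$ with the usual typing. $\mathcal{M}_f(X)$ is the set of finite multisets over $X$, $+$ is multiset union, $\mathrm{supp}(\mu)$ is the set of elements of non-zero multiplicity. Types as preorders. $[\![o]\!]=(\mathcal{C},=)$. For a preorder $P$, $!P$ has underlying set $\mathcal{M}_f(P)$ and $\mu\leq_{!P}\nu$ iff for all $a\in\mathrm{supp}(\mu)$ there is $a'\in\mathrm{supp}(\nu)$ with $a\leq_P a'$. $[\![A\to B]\!]=(![\![A]\!])^{\mathrm{op}}\times[\![B]\!]$, that is, the set $\mathcal{M}_f([\![A]\!])\times[\![B]\!]$ with $(\mu,b)\leq(\mu',b')$ iff $\mu'\leq\mu$ and $b\leq b'$. In the relational model a type is interpreted by the same set, without the preorder. A context $\Gamma=x_1:A_1,\dots,x_n:A_n$ is interpreted by the disjoint union $[\![\Gamma]\!]=\sum_i[\![A_i]\!]$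 (elements $(i,a)$; in the preorder, elements of distinct components are incomparable). A term $\Gamma\vdash M:A$ is interpreted in both models by a subset of $\mathcal{M}_f([\![\Gamma]\!])\times[\![A]\!]$. Interpretation in $\mathrm{Rel}_!$ (the Kleisli category of the finite multiset comonad on sets and relations), explicitly: $[\![x_i]\!]=\{([(i,a)],a)\mid a\in[\![A_i]\!]\}$; $[\![\lambda x^A.M]\!]=\{(\mu,(\nu,b))\mid (\mu+\nu',b)\in[\![M]\!]\}$, with $\nu'$ the multiset $\nu$ with its elements injected in the component of $x$; $[\![M\,N]\!]=\{(\mu_0+\mu_1+\dots+\mu_k,b)\mid k\in\mathbb{N},\ \exists a_1,\dots,a_k,\ (\mu_0,([a_1,\dots,a_k],b))\in[\![M]\!],\ (\mu_j,a_j)\in[\![N]\!]\text{ for }1\le j\le k\}$. Interpretation in $\mathrm{ScottL}_!$ (the Kleisli category of $!$ on the category $\mathrm{ScottL}$ of preorders and relations $\alpha\subseteq P\times Q$ such that $(p,q)\in\alpha$, $p\le p'$, $q'\le q$ imply $(p',q')\in\alpha$), explicitly: $[\![x_i]\!]=\{(\mu,a)\mid \exists (i,a')\in\mathrm{supp}(\mu),\ a\leq a'\}$; $[\![\lambda x^A.M]\!]=\{(\mu,(\nu,b))\mid(\mu+\nu',b)\in[\![M]\!]\}$, with $\nu'$ the multiset $\nu$ with its elements injected in the component of $x$; $[\![M\,N]\!]=\{(\mu,b)\mid\exists\nu\in\mathcal{M}_f([\![A]\!]),\ (\mu,(\nu,b))\in[\![M]\!]\text{ and }(\mu,a)\in[\![N]\!]\text{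 for all }a\in\mathrm{supp}(\nu)\}$. -}

module Defs where

open import Data.Empty.Polymorphic using (⊥)
open import Data.List.Base using (List; []; _∷_; [_]; _++_; map; concat)
open import Data.List.Membership.Propositional using () renaming (_∈_ to _∈ˡ_)
open import Data.List.Relation.Binary.Pointwise using (Pointwise)
open import Data.List.Relation.Unary.Any using (here; there)
open import Data.Product using (_×_; _,_; ∃-syntax; curry)
open import Data.Product.Relation.Binary.Pointwise.NonDependent
  using (×-preorder; ×-setoid)
open import Data.Sum.Base using (inj₁; inj₂)
open import Data.Sum.Relation.Binary.Pointwise using (⊎-preorder; inj₁; inj₂)
open import Level using (Level)
open import Relation.Binary.Bundles using (Preorder; Setoid)
open import Relation.Binary.Definitions using (_Respects_)
open import Relation.Binary.PropositionalEquality using (refl)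
open import Relation.Binary.PropositionalEquality.Properties using (preorder)
open import Relation.Binary.Properties.Preorder using (converse-preorder)
open import Relation.Unary using (Pred; _∈_)
import Data.List.Membership.Setoid as SetoidMembership
import Data.List.Relation.Binary.Permutation.Setoid as Permutation
import Data.List.Relation.Binary.Permutation.Setoid.Properties as PermutationProperties

infixr 7 _⇒_
infix  4 _⊢_

data Ty : Set where
  o   : Ty
  _⇒_ : Ty → Ty → Ty

-- The most recently bound variable is at the head.
Ctx : Set
Ctx = List Ty

data _⊢_ (Γ : Ctx) : Ty → Set where
  var : ∀ {A} → A ∈ˡ Γ → Γ ⊢ A
  lam : ∀ {A B} → A ∷ Γ ⊢ B → Γ ⊢ A ⇒ B
  app : ∀ {A B} → Γ ⊢ A ⇒ B → Γ ⊢ A → Γ ⊢ B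

-- Sets are setoids here, because there are no quotient types: a finite multiset
-- over P is a list, and two lists are equal as multisets when they are
-- permutations of each other up to the equality _≈_ of P.  Accordingly, supp(μ)
-- is list membership up to _≈_.
module _ {c : Level} where

  supp : (P : Preorder c c c) → let open Preorder P in List Carrier → Pred Carrier c
  supp P μ a = a ∈≈ μ
    where open SetoidMembership (Preorder.Eq.setoid P) using () renaming (_∈_ to _∈≈_)

  infix 9 !_

  !_ : Preorder c c c → Preorder c c c
  ! P = record
    { Carrier    = List P.Carrier
    ; _≈_        = _↭_
    ; _≲_        = λ μ ν → ∀ a → a ∈ supp P μ → ∃[ a' ] (a' ∈ supp P ν × a P.≲ a')
    ; isPreorder = record
      { isEquivalence = ↭-isEquivalence
      ; reflexive     = λ μ↭ν a a∈μ → a , ∈-resp-↭ μ↭ν a∈μ , P.refl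
      ; trans         = λ μ≲ν ν≲ρ a a∈μ →
          let (a' , a'∈ν , a≲a')  = μ≲ν a a∈μ
              (a″ , a″∈ρ , a'≲a″) = ν≲ρ a' a'∈ν
          in a″ , a″∈ρ , P.trans a≲a' a'≲a″
      }
    }
    where
    module P = Preorder P
    open Permutation P.Eq.setoid using (_↭_; ↭-isEquivalence)
    open PermutationProperties P.Eq.setoid using (∈-resp-↭)

module Interpretation {c : Level} (C : Set c) where

  -- Both models use the same underlying set; the relational model ignores _≲_.
  ⟦_⟧ty : Ty → Preorder c c c
  ⟦ o ⟧ty     = preorder C
  ⟦ A ⇒ B ⟧ty = ×-preorder (converse-preorder (! ⟦ A ⟧ty)) ⟦ B ⟧ty

  -- The n-ary disjoint union of preorders, as an iterated binary one.
  ⟦_⟧ctx : Ctx → Preorder c c c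
  ⟦ [] ⟧ctx    = preorder ⊥
  ⟦ A ∷ Γ ⟧ctx = ⊎-preorder ⟦ A ⟧ty ⟦ Γ ⟧ctx

  private
    module T (A : Ty)  = Preorder ⟦ A ⟧ty
    module G (Γ : Ctx) = Preorder ⟦ Γ ⟧ctx
    module M (Γ : Ctx) = Preorder (! ⟦ Γ ⟧ctx)
    module ↭ (Γ : Ctx) where
      open Permutation (G.Eq.setoid Γ) public
      open PermutationProperties (G.Eq.setoid Γ) public

  El : Ty → Set c
  El A = T.Carrier A

  Point : Ctx → Ty → Set c
  Point Γ A = M.Carrier Γ × El A

  -- (i , a) in the disjoint union.
  inject : ∀ {Γ A} → A ∈ˡ Γ → El A → G.Carrier Γ
  inject (here refl) a = inj₁ a
  inject (there i)   a = inj₂ (inject i a)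

  -- μ + ν', where ν' is ν injected in the component of the bound variable.
  extend : ∀ Γ A → M.Carrier Γ → List (El A) → M.Carrier (A ∷ Γ)
  extend Γ A μ ν = map inj₂ μ ++ map inj₁ ν

  -- In an application, μs = μ₁ , … , μₖ and as = a₁ , … , aₖ; Pointwise makes
  -- their lengths agree.
  ⟦_⟧Rel : ∀ {Γ A} → Γ ⊢ A → Pred (Point Γ A) c
  ⟦_⟧Rel {Γ} (var i)     (μ , a)       = M._≈_ Γ μ [ inject i a ]
  ⟦_⟧Rel {Γ} (lam {A} M) (μ , (ν , b)) = ⟦ M ⟧Rel (extend Γ A μ ν , b)
  ⟦_⟧Rel {Γ} (app M N)   (μ , b)       =
    ∃[ μ₀ ] ∃[ μs ] ∃[ as ]
      ( M._≈_ Γ μ (μ₀ ++ concat μs)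
      × ⟦ M ⟧Rel (μ₀ , (as , b))
      × Pointwise (curry ⟦ N ⟧Rel) μs as )

  ⟦_⟧ScottL : ∀ {Γ A} → Γ ⊢ A → Pred (Point Γ A) c
  ⟦_⟧ScottL {Γ} {A} (var i)       (μ , a)       =
    ∃[ a' ] (inject i a' ∈ supp ⟦ Γ ⟧ctx μ × T._≲_ A a a')
  ⟦_⟧ScottL {Γ}     (lam {A} M)   (μ , (ν , b)) = ⟦ M ⟧ScottL (extend Γ A μ ν , b)
  ⟦_⟧ScottL         (app {A} M N) (μ , b)       =
    ∃[ ν ] ( ⟦ M ⟧ScottL (μ , (ν , b))
           × (∀ a → a ∈ supp ⟦ A ⟧ty ν → ⟦ N ⟧ScottL (μ , a)) )

  -- Γ and A are explicit since they cannot be inferred from Point Γ A.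
  DownClosure : ∀ Γ A → Pred (Point Γ A) c → Pred (Point Γ A) c
  DownClosure Γ A X (μ , a) =
    ∃[ μ' ] ∃[ a' ] ((μ' , a') ∈ X × M._≲_ Γ μ' μ × T._≲_ A a a')

  -- The interpretations are subsets of the multisets, not just of the lists
  -- representing them.
  private
    point-setoid : Ctx → Ty → Setoid c c
    point-setoid Γ A = ×-setoid (M.Eq.setoid Γ) (T.Eq.setoid A)

    inject-cong : ∀ {Γ A} (i : A ∈ˡ Γ) {a b} → T._≈_ A a b →
                  G._≈_ Γ (inject i a) (inject i b)
    inject-cong (here refl) a≈b = inj₁ a≈b
    inject-cong (there i)   a≈b = inj₂ (inject-cong i a≈b)

    extend-cong : ∀ Γ A {μ μ' ν ν'} → M._≈_ Γ μ μ' →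
                  Preorder._≈_ (! ⟦ A ⟧ty) ν ν' →
                  M._≈_ (A ∷ Γ) (extend Γ A μ ν) (extend Γ A μ' ν')
    extend-cong Γ A p q = ↭.++⁺ (A ∷ Γ)
      (↭.map⁺ Γ (G.Eq.setoid (A ∷ Γ)) inj₂ p)
      (PermutationProperties.map⁺ (T.Eq.setoid A) (G.Eq.setoid (A ∷ Γ)) inj₁ q)

  Rel-respects : ∀ {Γ A} (M : Γ ⊢ A) →
                 ⟦ M ⟧Rel Respects Setoid._≈_ (point-setoid Γ A)
  Rel-respects {Γ} (var i) (p , q) r =
    M.Eq.trans Γ (M.Eq.sym Γ p)
      (M.Eq.trans Γ r (Permutation.prep (inject-cong i q) (M.Eq.refl Γ)))
  Rel-respects {Γ} (lam {A} M) (p , (q , r)) =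
    Rel-respects M (extend-cong Γ A p q , r)
  Rel-respects {Γ} (app {A} M N) (p , q) (μ₀ , μs , as , e , m , n) =
    μ₀ , μs , as , M.Eq.trans Γ (M.Eq.sym Γ p) e
    , Rel-respects M (M.Eq.refl Γ , (Preorder.Eq.refl (! ⟦ A ⟧ty) , q)) m , n

  ScottL-respects : ∀ {Γ A} (M : Γ ⊢ A) →
                    ⟦ M ⟧ScottL Respects Setoid._≈_ (point-setoid Γ A)
  ScottL-respects {Γ} {A} (var i) (p , q) (a' , i∈ , a≲) =
    a' , ↭.∈-resp-↭ Γ p i∈ , T.trans A (T.reflexive A (T.Eq.sym A q)) a≲
  ScottL-respects {Γ} (lam {A} M) (p , (q , r)) =
    ScottL-respects M (extend-cong Γ A p q , r)
  ScottL-respects {Γ} (app {A} M N) (p , q) (ν , m , n) =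
    ν , ScottL-respects M (p , (Preorder.Eq.refl (! ⟦ A ⟧ty) , q)) m
    , λ a a∈ν → ScottL-respects N (p , T.Eq.refl A) (n a a∈ν)

{-# OPTIONS --safe #-}
-- For subsets x and s of ⟦A⟧, let s be the down-closure of x and, when A is an
-- arrow type, require the same hereditarily of x · y and s · t for related y and
-- t.  The two interpretations of a term in related environments are related in
-- this way.  The abstraction case works because every down-closed set is related
-- to itself, so that a finite multiset ν can be tested by taking the down-closure
-- of its support as the argument.  The theorem is the instance where both
-- environments are the down-closure of the support of μ.
module Submission where

open import Defs
open import Data.List.Base using (List; []; _∷_; _++_; map; concat)
open import Data.List.Membership.Propositional using () renaming (_∈_ to _∈ˡ_)
open import Data.List.Relation.Binary.Pointwise using (Pointwise; []; _∷_)
open import Data.List.Relation.Unary.All as All using (All; []; _∷_)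
import Data.List.Relation.Unary.All.Properties as AllP
open import Data.List.Relation.Unary.Any using (here; there)
import Data.List.Relation.Unary.Any.Properties as AnyP
open import Data.Product using (_×_; _,_; ∃-syntax; curry; proj₁; proj₂)
open import Data.Sum.Base using ([_,_]; inj₁; inj₂)
open import Data.Sum.Relation.Binary.Pointwise using (inj₁; inj₂)
open import Function.Base using (_∘_)
open import Level using (Level; Lift; lift; lower) renaming (suc to lsuc)
open import Relation.Binary.Bundles using (Preorder)
open import Relation.Binary.Definitions using (_Respects_)
open import Relation.Binary.PropositionalEquality using (refl)
open import Relation.Unary using (Pred; _∈_; _⊆_; _≐_)
open import Relation.Unary.Properties using (≐-refl; ≐-sym; ≐-trans)
import Data.List.Membership.Setoid.Properties as Membership
import Data.List.Relation.Binary.Permutation.Setoid as Permutation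
import Data.List.Relation.Binary.Permutation.Setoid.Properties as PermutationProperties

-- Down-closure in a preorder and the order on finite multisets.

module _ {c : Level} (P : Preorder c c c) where
  open Preorder P

  ↓ : Pred Carrier c → Pred Carrier c
  ↓ X a = ∃[ b ] (b ∈ X × a ≲ b)

  DownClosed : Pred Carrier c → Set c
  DownClosed X = ∀ {a b} → a ≲ b → b ∈ X → a ∈ X

  ↓-downClosed : ∀ X → DownClosed (↓ X)
  ↓-downClosed X a≲b (b' , b'∈X , b≲b') = b' , b'∈X , trans a≲b b≲b'

  ⊆-↓ : ∀ X → X ⊆ ↓ X
  ⊆-↓ X {a} a∈X = a , a∈X , Preorder.refl P

  ↓-cong : ∀ {X Y} → X ≐ Y → ↓ X ≐ ↓ Y
  ↓-cong (X⊆Y , Y⊆X) = (λ (b , b∈X , a≲b) → b , X⊆Y b∈X , a≲b)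
                     , (λ (b , b∈Y , a≲b) → b , Y⊆X b∈Y , a≲b)

  ↓-idem : ∀ {X} → DownClosed X → X ≐ ↓ X
  ↓-idem {X} X↓ = ⊆-↓ X , λ (b , b∈X , a≲b) → X↓ a≲b b∈X

  downClosed-respects : ∀ {X} → DownClosed X → X Respects _≈_
  downClosed-respects X↓ a≈b = X↓ (reflexive (Eq.sym a≈b))

  ≐-↓⇒downClosed : ∀ {X Y} → X ≐ ↓ Y → DownClosed X
  ≐-↓⇒downClosed {Y = Y} (X⊆ , ⊆X) a≲b b∈X = ⊆X (↓-downClosed Y a≲b (X⊆ b∈X))

  ↓supp : List Carrier → Pred Carrier c
  ↓supp μ = ↓ (supp P μ)

  ↓supp-respects : ∀ μ → ↓supp μ Respects _≈_
  ↓supp-respects μ = downClosed-respects (↓-downClosed (supp P μ))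

  All-supp : ∀ μ → All (supp P μ) μ
  All-supp μ = All.tabulateₛ Eq.setoid (λ a∈μ → a∈μ)

  All-↓supp : ∀ μ → All (↓supp μ) μ
  All-↓supp μ = All.map (⊆-↓ (supp P μ)) (All-supp μ)

  -- In the `All` form, the order on multisets becomes the side condition of an application to the
  -- subset `↓supp ν`.
  ≲⇒All : ∀ {μ ν} → Preorder._≲_ (! P) μ ν → All (↓supp ν) μ
  ≲⇒All μ≲ν = All.tabulateₛ Eq.setoid (λ {a} → μ≲ν a)

  All⇒≲ : ∀ {μ ν} → All (↓supp ν) μ → Preorder._≲_ (! P) μ ν
  All⇒≲ {ν = ν} all a = All.lookupₛ Eq.setoid (↓supp-respects ν) all

  ⊆supp⇒≲ : ∀ {μ ν} → supp P μ ⊆ supp P ν → Preorder._≲_ (! P) μ ν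
  ⊆supp⇒≲ μ⊆ν a a∈μ = a , μ⊆ν a∈μ , Preorder.refl P

  -- Each element of `ν` is replaced by its witness in `X`. The order of `! P` asks only for some
  -- larger element in the support, so the witnesses together dominate `ν`.
  choose : ∀ {X ν} → All (↓ X) ν → ∃[ ν' ] (All X ν' × Preorder._≲_ (! P) ν ν')
  choose {X} all = let (ν' , all' , below) = go all in ν' , all' , All⇒≲ below
    where
    go : ∀ {ν} → All (↓ X) ν → ∃[ ν' ] (All X ν' × All (↓supp ν') ν)
    go [] = [] , [] , []
    go ((b , b∈X , a≲b) ∷ as) =
      let (ν' , all' , below) = go as
      in b ∷ ν' , b∈X ∷ all'
         , (b , here Eq.refl , a≲b)
           ∷ All.map (λ (d , d∈ν' , e≲d) → d , there d∈ν' , e≲d) below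

-- The logical relation between the two models.

module _ {c : Level} (C : Set c) where
  open Interpretation C

  private
    module T (A : Ty)  = Preorder ⟦ A ⟧ty
    module G (Γ : Ctx) = Preorder ⟦ Γ ⟧ctx
    module M (Γ : Ctx) = Preorder (! ⟦ Γ ⟧ctx)
    module P (Γ : Ctx) = PermutationProperties (G.Eq.setoid Γ)

  Sub : Ty → Set (lsuc c)
  Sub A = Pred (El A) c

  Env : Ctx → Set (lsuc c)
  Env Γ = Pred (G.Carrier Γ) c

  infixl 7 _·_

  -- Also used to apply the interpretation of a term to an environment, since a
  -- Point is a pair of the same shape.
  _·_ : ∀ {X Y : Set c} → Pred (List X × Y) c → Pred X c → Pred Y c
  (x · y) b = ∃[ ν ] ((ν , b) ∈ x × All y ν)

  ·-congˡ : ∀ {X Y : Set c} {x x' : Pred (List X × Y) c} {y} → x ≐ x' → x · y ≐ x' · y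
  ·-congˡ (x⊆ , ⊆x) = (λ (ν , p , all) → ν , x⊆ p , all)
                    , (λ (ν , p , all) → ν , ⊆x p , all)

  -- Only the relational argument `y` is asked to respect `_≈_`: the Scott side `t` equals a
  -- down-closure, hence is down-closed and respects it automatically.
  Related : ∀ A → Sub A → Sub A → Set (lsuc c)
  Related o       x s = Lift (lsuc c) (s ≐ ↓ ⟦ o ⟧ty x)
  Related (A ⇒ B) x s =
    s ≐ ↓ ⟦ A ⇒ B ⟧ty x ×
    (∀ y t → y Respects T._≈_ A → Related A y t → Related B (x · y) (s · t))

  related⇒≐ : ∀ A {x s} → Related A x s → s ≐ ↓ ⟦ A ⟧ty x
  related⇒≐ o       r = lower r
  related⇒≐ (A ⇒ B) r = proj₁ r

  related-cong : ∀ A {x x' s s'} → x ≐ x' → s ≐ s' → Related A x s → Related A x' s'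
  related-cong o x≐ s≐ (lift r) =
    lift (≐-trans (≐-sym s≐) (≐-trans r (↓-cong ⟦ o ⟧ty x≐)))
  related-cong (A ⇒ B) x≐ s≐ (r , app-r) =
      ≐-trans (≐-sym s≐) (≐-trans r (↓-cong ⟦ A ⇒ B ⟧ty x≐))
    , λ y t y≈ yt → related-cong B (·-congˡ x≐) (·-congˡ s≐) (app-r y t y≈ yt)

  -- At an arrow type, `s` is up-closed in its multiset argument. A multiset over `t`, the
  -- down-closure of `y`, can therefore be raised by `choose` to one over `y`, so `s · t` and
  -- `s · y` coincide. This common set is down-closed, and induction on the type applies.
  downClosed⇒related : ∀ A {s} → DownClosed ⟦ A ⟧ty s → Related A s s
  downClosed⇒related o           s↓ = lift (↓-idem ⟦ o ⟧ty s↓)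
  downClosed⇒related (A ⇒ B) {s} s↓ = ↓-idem ⟦ A ⇒ B ⟧ty s↓ , λ y t _ yt →
    let (t⊆ , ⊆t) = related⇒≐ A yt
        st⊆sy : s · t ⊆ s · y
        st⊆sy (ν , p , all) =
          let (ν' , all' , ν≲ν') = choose ⟦ A ⟧ty (All.map t⊆ all)
          in ν' , s↓ (ν≲ν' , T.refl B) p , all'
        sy⊆st : s · y ⊆ s · t
        sy⊆st (ν , p , all) = ν , p , All.map (⊆t ∘ ⊆-↓ ⟦ A ⟧ty y) all
        st↓ : DownClosed ⟦ B ⟧ty (s · t)
        st↓ a≲b (ν , p , all) = ν , s↓ (Preorder.refl (! ⟦ A ⟧ty) , a≲b) p , all
    in related-cong B (st⊆sy , sy⊆st) ≐-refl (downClosed⇒related B st↓)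

  -- Environments as subsets of the disjoint union, related component by component.

  record RelatedEnv (Γ : Ctx) (ρ σ : Env Γ) : Set (lsuc c) where
    field
      respectsˡ : ρ Respects G._≈_ Γ
      respectsʳ : σ Respects G._≈_ Γ
      related   : ∀ {A} (i : A ∈ˡ Γ) → Related A (ρ ∘ inject i) (σ ∘ inject i)
  open RelatedEnv

  relatedEnv-∷ : ∀ {Γ A ρ σ y t} → y Respects T._≈_ A → Related A y t →
                 RelatedEnv Γ ρ σ → RelatedEnv (A ∷ Γ) [ y , ρ ] [ t , σ ]
  relatedEnv-∷ y≈ yt ρσ .respectsˡ (inj₁ p) = y≈ p
  relatedEnv-∷ y≈ yt ρσ .respectsˡ (inj₂ p) = ρσ .respectsˡ p
  relatedEnv-∷ {A = A} y≈ yt ρσ .respectsʳ (inj₁ p) =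
    downClosed-respects ⟦ A ⟧ty (≐-↓⇒downClosed ⟦ A ⟧ty (related⇒≐ A yt)) p
  relatedEnv-∷ y≈ yt ρσ .respectsʳ (inj₂ p) = ρσ .respectsʳ p
  relatedEnv-∷ y≈ yt ρσ .related (here refl) = yt
  relatedEnv-∷ y≈ yt ρσ .related (there i)   = ρσ .related i

  inject-mono : ∀ {Γ A} (i : A ∈ˡ Γ) {a b} → T._≲_ A a b →
                G._≲_ Γ (inject i a) (inject i b)
  inject-mono (here refl) a≲b = inj₁ a≲b
  inject-mono (there i)   a≲b = inj₂ (inject-mono i a≲b)

  -- Distinct components are incomparable, so going up never leaves the component of `i`. This
  -- serves the variable case of `ScottL-mono`.
  inject-≲⁻ : ∀ {Γ A} (i : A ∈ˡ Γ) {a g} → G._≲_ Γ (inject i a) g →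
              ∃[ b ] (G._≈_ Γ g (inject i b) × T._≲_ A a b)
  inject-≲⁻ {A ∷ Γ} (here refl) (inj₁ {c = b} a≲b) = b , G.Eq.refl (A ∷ Γ) , a≲b
  inject-≲⁻ (there i)   (inj₂ i≲) =
    let (b , g≈ , a≲b) = inject-≲⁻ i i≲ in b , inj₂ g≈ , a≲b

  relatedEnv-downClosed : ∀ Γ {ρ} → DownClosed ⟦ Γ ⟧ctx ρ → RelatedEnv Γ ρ ρ
  relatedEnv-downClosed Γ ρ↓ .respectsˡ = downClosed-respects ⟦ Γ ⟧ctx ρ↓
  relatedEnv-downClosed Γ ρ↓ .respectsʳ = downClosed-respects ⟦ Γ ⟧ctx ρ↓
  relatedEnv-downClosed Γ ρ↓ .related {A} i =
    downClosed⇒related A (ρ↓ ∘ inject-mono i)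

  -- Monotonicity of the Scott interpretation.

  extend-mono : ∀ Γ A {μ μ' ν ν'} → M._≲_ Γ μ μ' → Preorder._≲_ (! ⟦ A ⟧ty) ν ν' →
                M._≲_ (A ∷ Γ) (extend Γ A μ ν) (extend Γ A μ' ν')
  extend-mono Γ A {μ} {μ'} {ν} {ν'} μ≲μ' ν≲ν' =
    All⇒≲ ⟦ A ∷ Γ ⟧ctx (AllP.++⁺
      (AllP.map⁺ (All.map
        (λ (g , g∈ , ≲g) → inj₂ g
          , AnyP.++⁺ˡ (Membership.∈-map⁺ (G.Eq.setoid Γ) (G.Eq.setoid (A ∷ Γ)) inj₂ g∈)
          , inj₂ ≲g)
        (≲⇒All ⟦ Γ ⟧ctx μ≲μ')))
      (AllP.map⁺ (All.map
        (λ (a , a∈ , ≲a) → inj₁ a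
          , AnyP.++⁺ʳ (map inj₂ μ')
              (Membership.∈-map⁺ (T.Eq.setoid A) (G.Eq.setoid (A ∷ Γ)) inj₁ a∈)
          , inj₁ ≲a)
        (≲⇒All ⟦ A ⟧ty ν≲ν'))))

  -- This is the closure condition on morphisms of the category ScottL.
  ScottL-mono : ∀ {Γ A} (M : Γ ⊢ A) {μ μ' a a'} → M._≲_ Γ μ μ' → T._≲_ A a' a →
                ⟦ M ⟧ScottL (μ , a) → ⟦ M ⟧ScottL (μ' , a')
  ScottL-mono {Γ} {A} (var i) μ≲ a≲ (b , b∈μ , a≲b) =
    let (g , g∈μ' , b≲g) = μ≲ _ b∈μ
        (d , g≈d , b≲d) = inject-≲⁻ i b≲g
    in d , Membership.∈-resp-≈ (G.Eq.setoid Γ) g≈d g∈μ'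
       , T.trans A a≲ (T.trans A a≲b b≲d)
  ScottL-mono {Γ} (lam {A} M) μ≲ (ν≲ , b≲) m =
    ScottL-mono M (extend-mono Γ A μ≲ ν≲) b≲ m
  ScottL-mono (app {A} M N) μ≲ b≲ (ν , m , n) =
    ν , ScottL-mono M μ≲ (Preorder.refl (! ⟦ A ⟧ty) , b≲) m
    , λ a a∈ν → ScottL-mono N μ≲ (T.refl A) (n a a∈ν)

  -- Term constructors evaluated in environments.

  extend-∷ : ∀ Γ A a μ ν → M._≈_ (A ∷ Γ) (inj₁ a ∷ extend Γ A μ ν) (extend Γ A μ (a ∷ ν))
  extend-∷ Γ A a μ ν = M.Eq.sym (A ∷ Γ) (P.↭-shift (A ∷ Γ) (map inj₂ μ) (map inj₁ ν))

  -- The list `κ` may interleave the two components, while `extend` puts the context first; hence a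
  -- permutation rather than an equality of lists.
  split : ∀ Γ A {y : Sub A} {ρ : Env Γ} {κ} → All [ y , ρ ] κ →
          ∃[ μ ] ∃[ ν ] (M._≈_ (A ∷ Γ) κ (extend Γ A μ ν) × All ρ μ × All y ν)
  split Γ A [] = [] , [] , M.Eq.refl (A ∷ Γ) , [] , []
  split Γ A {κ = inj₁ a ∷ κ} (p ∷ ps) =
    let (μ , ν , κ≈ , μs , νs) = split Γ A ps
    in μ , a ∷ ν
       , M.Eq.trans (A ∷ Γ) (Permutation.prep (G.Eq.refl (A ∷ Γ)) κ≈) (extend-∷ Γ A a μ ν)
       , μs , p ∷ νs
  split Γ A {κ = inj₂ g ∷ κ} (p ∷ ps) =
    let (μ , ν , κ≈ , μs , νs) = split Γ A ps
    in g ∷ μ , ν , Permutation.prep (G.Eq.refl (A ∷ Γ)) κ≈ , p ∷ μs , νs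

  All-extend : ∀ Γ A {y : Sub A} {ρ : Env Γ} {μ ν} → All ρ μ → All y ν →
               All [ y , ρ ] (extend Γ A μ ν)
  All-extend Γ A μs νs = AllP.++⁺ (AllP.map⁺ μs) (AllP.map⁺ νs)

  Rel-lam : ∀ {Γ A B} (M : A ∷ Γ ⊢ B) ρ y →
              ⟦ M ⟧Rel · [ y , ρ ] ≐ ⟦ lam M ⟧Rel · ρ · y
  Rel-lam {Γ} {A} {B} M ρ y =
      (λ (κ , m , all) →
        let (μ , ν , κ≈ , μs , νs) = split Γ A all
        in ν , (μ , Rel-respects M (κ≈ , T.Eq.refl B) m , μs) , νs)
    , (λ (ν , (μ , m , μs) , νs) → extend Γ A μ ν , m , All-extend Γ A μs νs)

  ScottL-lam : ∀ {Γ A B} (M : A ∷ Γ ⊢ B) σ t →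
                 ⟦ M ⟧ScottL · [ t , σ ] ≐ ⟦ lam M ⟧ScottL · σ · t
  ScottL-lam {Γ} {A} {B} M σ t =
      (λ (κ , m , all) →
        let (μ , ν , κ≈ , μs , νs) = split Γ A all
        in ν , (μ , ScottL-respects M (κ≈ , T.Eq.refl B) m , μs) , νs)
    , (λ (ν , (μ , m , μs) , νs) → extend Γ A μ ν , m , All-extend Γ A μs νs)

  Rel-var : ∀ {Γ A} (i : A ∈ˡ Γ) {ρ} → ρ Respects G._≈_ Γ →
               ρ ∘ inject i ≐ ⟦ var i ⟧Rel · ρ
  Rel-var {Γ} i ρ≈ =
      (λ {a} p → _ , M.Eq.refl Γ , p ∷ [])
    , (λ (μ , μ≈ , all) → All.head (P.All-resp-↭ Γ ρ≈ μ≈ all))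

  ScottL-var : ∀ {Γ A} (i : A ∈ˡ Γ) {σ} → σ Respects G._≈_ Γ →
                  DownClosed ⟦ A ⟧ty (σ ∘ inject i) →
                  σ ∘ inject i ≐ ⟦ var i ⟧ScottL · σ
  ScottL-var {Γ} {A} i σ≈ σ↓ =
      (λ {a} p → _ , (a , here (G.Eq.refl Γ) , T.refl A) , p ∷ [])
    , (λ (μ , (a' , a'∈ , a≲a') , all) →
        σ↓ a≲a' (All.lookupₛ (G.Eq.setoid Γ) σ≈ all a'∈))

  gather-Rel : ∀ {Γ A} (N : Γ ⊢ A) {ρ as} → All (⟦ N ⟧Rel · ρ) as →
               ∃[ μs ] (Pointwise (curry ⟦ N ⟧Rel) μs as × All (All ρ) μs)
  gather-Rel N [] = [] , [] , []
  gather-Rel N ((μ , n , all) ∷ ps) =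
    let (μs , ns , alls) = gather-Rel N ps in μ ∷ μs , n ∷ ns , all ∷ alls

  scatter-Rel : ∀ {Γ A} (N : Γ ⊢ A) {ρ μs as} → Pointwise (curry ⟦ N ⟧Rel) μs as →
                All (All ρ) μs → All (⟦ N ⟧Rel · ρ) as
  scatter-Rel N []       []           = []
  scatter-Rel N (n ∷ ns) (all ∷ alls) = (_ , n , all) ∷ scatter-Rel N ns alls

  -- The relational model keeps one context multiset per argument, so the witnesses are simply
  -- concatenated, or cut apart again.
  Rel-app : ∀ {Γ A B} (M : Γ ⊢ A ⇒ B) (N : Γ ⊢ A) {ρ} → ρ Respects G._≈_ Γ →
               ⟦ M ⟧Rel · ρ · (⟦ N ⟧Rel · ρ) ≐ ⟦ app M N ⟧Rel · ρ
  Rel-app {Γ} M N ρ≈ =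
      (λ (as , (μ₀ , m , all₀) , ns) →
        let (μs , ns' , alls) = gather-Rel N ns
        in μ₀ ++ concat μs , (μ₀ , μs , as , M.Eq.refl Γ , m , ns')
           , AllP.++⁺ all₀ (AllP.concat⁺ alls))
    , (λ (μ , (μ₀ , μs , as , μ≈ , m , ns) , all) →
        let (all₀ , alls) = AllP.++⁻ μ₀ (P.All-resp-↭ Γ ρ≈ μ≈ all)
        in as , (μ₀ , m , all₀) , scatter-Rel N ns (AllP.concat⁻ alls))

  ≲-++ˡ : ∀ Γ μ ν → M._≲_ Γ μ (μ ++ ν)
  ≲-++ˡ Γ μ ν = ⊆supp⇒≲ ⟦ Γ ⟧ctx AnyP.++⁺ˡ

  ≲-++ʳ : ∀ Γ μ ν → M._≲_ Γ ν (μ ++ ν)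
  ≲-++ʳ Γ μ ν = ⊆supp⇒≲ ⟦ Γ ⟧ctx (AnyP.++⁺ʳ μ)

  -- Scott application shares a single context multiset among all arguments. The separate witnesses
  -- are united, and monotonicity carries each membership to the union.
  gather-ScottL : ∀ {Γ A} (N : Γ ⊢ A) {σ as} → All (⟦ N ⟧ScottL · σ) as →
                  ∃[ μ ] (All σ μ × All (curry ⟦ N ⟧ScottL μ) as)
  gather-ScottL N [] = [] , [] , []
  gather-ScottL {Γ} {A} N ((μ , n , all) ∷ ps) =
    let (μ' , all' , ns) = gather-ScottL N ps
    in μ ++ μ' , AllP.++⁺ all all'
       , ScottL-mono N (≲-++ˡ Γ μ μ') (T.refl A) n
         ∷ All.map (ScottL-mono N (≲-++ʳ Γ μ μ') (T.refl A)) ns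

  ScottL-app : ∀ {Γ A B} (M : Γ ⊢ A ⇒ B) (N : Γ ⊢ A) σ →
                  ⟦ M ⟧ScottL · σ · (⟦ N ⟧ScottL · σ) ≐ ⟦ app M N ⟧ScottL · σ
  ScottL-app {Γ} {A} {B} M N σ =
      (λ (ν , (μ₀ , m , all₀) , ns) →
        let (μ₁ , all₁ , ns') = gather-ScottL N ns
        in μ₀ ++ μ₁
           , ( ν
             , ScottL-mono M (≲-++ˡ Γ μ₀ μ₁) (T.refl (A ⇒ B)) m
             , λ a a∈ν → ScottL-mono N (≲-++ʳ Γ μ₀ μ₁) (T.refl A)
                 (All.lookupₛ (T.Eq.setoid A)
                   (λ a≈b → ScottL-respects N (M.Eq.refl Γ , a≈b)) ns' a∈ν))
           , AllP.++⁺ all₀ all₁)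
    , (λ (μ , (ν , m , n) , all) →
        ν , (μ , m , all)
        , All.tabulateₛ (T.Eq.setoid A) (λ {a} a∈ν → μ , n a a∈ν , all))

  -- The fundamental lemma, by induction on terms.

  Rel-·-respects : ∀ {Γ A} (M : Γ ⊢ A) ρ → (⟦ M ⟧Rel · ρ) Respects T._≈_ A
  Rel-·-respects {Γ} M ρ a≈b (μ , m , all) =
    μ , Rel-respects M (M.Eq.refl Γ , a≈b) m , all

  relatedEnv-∷-↓supp : ∀ {Γ A ρ σ} ν → RelatedEnv Γ ρ σ →
                       RelatedEnv (A ∷ Γ) [ ↓supp ⟦ A ⟧ty ν , ρ ] [ ↓supp ⟦ A ⟧ty ν , σ ]
  relatedEnv-∷-↓supp {A = A} ν =
    relatedEnv-∷ (↓supp-respects ⟦ A ⟧ty ν)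
      (downClosed⇒related A (↓-downClosed ⟦ A ⟧ty (supp ⟦ A ⟧ty ν)))

  fundamental : ∀ {Γ A} (M : Γ ⊢ A) {ρ σ} → RelatedEnv Γ ρ σ →
                Related A (⟦ M ⟧Rel · ρ) (⟦ M ⟧ScottL · σ)
  fundamental {Γ} {A} (var i) ρσ =
    related-cong A
      (Rel-var i (ρσ .respectsˡ))
      (ScottL-var i (ρσ .respectsʳ)
        (≐-↓⇒downClosed ⟦ A ⟧ty (related⇒≐ A (ρσ .related i))))
      (ρσ .related i)
  fundamental {Γ} (lam {A} {B} M) {ρ} {σ} ρσ =
      -- The body, evaluated with `↓supp ν` for the bound variable, yields `b'` above `b`. The part
      -- `ν'` that the relational side uses of this argument lies below `ν`, so contravariance puts
      -- `(ν , b)` below `(ν' , b')`.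
      ( (λ {(ν , b)} (μ , m , all) →
          let (b' , m' , b≲b') = proj₁ (body≐ ν)
                (extend Γ A μ ν , m , All-extend Γ A all (All-↓supp ⟦ A ⟧ty ν))
              (ν' , m″ , all') = proj₁ (Rel-lam M ρ (↓supp ⟦ A ⟧ty ν)) m'
          in (ν' , b') , m″ , All⇒≲ ⟦ A ⟧ty all' , b≲b')
      -- Conversely, `ν'` is a multiset over `↓supp ν`. The Scott side returns some `ν″` below `ν`,
      -- which `ScottL-mono` raises to `ν` itself.
      , (λ {(ν , b)} ((ν' , b') , (μ , m , all) , ν'≲ν , b≲b') →
          let (ν″ , (μ' , m' , all') , all″) =
                proj₁ (ScottL-lam M σ (↓supp ⟦ A ⟧ty ν)) (proj₂ (body≐ ν)
                  (b' , (extend Γ A μ ν' , m , All-extend Γ A all (≲⇒All ⟦ A ⟧ty ν'≲ν))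
                  , b≲b'))
          in μ' , ScottL-mono (lam M) (M.refl Γ) (All⇒≲ ⟦ A ⟧ty all″ , T.refl B) m' , all')
      )
    , λ y t y≈ yt → related-cong B (Rel-lam M ρ y) (ScottL-lam M σ t)
        (fundamental M (relatedEnv-∷ y≈ yt ρσ))
    where
    body≐ : ∀ ν → ⟦ M ⟧ScottL · [ ↓supp ⟦ A ⟧ty ν , σ ] ≐
                  ↓ ⟦ B ⟧ty (⟦ M ⟧Rel · [ ↓supp ⟦ A ⟧ty ν , ρ ])
    body≐ ν = related⇒≐ B (fundamental M (relatedEnv-∷-↓supp ν ρσ))
  fundamental (app {A} {B} M N) {ρ} {σ} ρσ =
    related-cong B (Rel-app M N (ρσ .respectsˡ)) (ScottL-app M N σ)
      (proj₂ (fundamental M ρσ) _ _ (Rel-·-respects N ρ) (fundamental N ρσ))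

  -- Environments generated by a single multiset.

  ScottL≐↓Rel : ∀ {Γ A} (M : Γ ⊢ A) μ →
                let ρ = ↓supp ⟦ Γ ⟧ctx μ in
                ⟦ M ⟧ScottL · ρ ≐ ↓ ⟦ A ⟧ty (⟦ M ⟧Rel · ρ)
  ScottL≐↓Rel {Γ} {A} M μ = related⇒≐ A (fundamental M
    (relatedEnv-downClosed Γ (↓-downClosed ⟦ Γ ⟧ctx (supp ⟦ Γ ⟧ctx μ))))

theorem6p16 : ∀ {c : Level} (C : Set c) {Γ : Ctx} {A : Ty} (M : Γ ⊢ A) →
    let open Interpretation C in
    ⟦ M ⟧ScottL ≐ DownClosure Γ A ⟦ M ⟧Rel
theorem6p16 C {Γ} {A} M =
    (λ {(μ , a)} m →
      let (a' , (μ' , m' , all) , a≲a') =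
            proj₁ (ScottL≐↓Rel C M μ) (μ , m , All-↓supp ⟦ Γ ⟧ctx μ)
      in μ' , a' , m' , All⇒≲ ⟦ Γ ⟧ctx all , a≲a')
  -- The multiset `μ″` obtained from the environment `↓supp μ` is only known to lie below `μ`;
  -- monotonicity restores `μ`.
  , (λ {(μ , a)} (μ' , a' , m' , μ'≲μ , a≲a') →
      let (μ″ , m , all) =
            proj₂ (ScottL≐↓Rel C M μ) (a' , (μ' , m' , ≲⇒All ⟦ Γ ⟧ctx μ'≲μ) , a≲a')
      in ScottL-mono C M (All⇒≲ ⟦ Γ ⟧ctx all) (Preorder.refl ⟦ A ⟧ty) m)
  where open Interpretation C
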